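{- Let $a \in \mathbf{F}_q$ be a nonzero element that is a square in $\mathbf{F}_q$, and let $\sqrt{a}\in \mathbf{F}_q$ denote a square root of $a$. Let $f(x) \in \mathbf{F}_q[x]$ be a nontrivial $a$-self reciprocal monic polynomial of degree $n=2m$. If $f(x)$ is not divisible by $x^2-a$ and $f(\sqrt{a})=0$, then $f(x)$ can be written as $f(x) = (x-\sqrt{a})^k\cdot g(x)$, where $k$ is even and $g(x) \in \mathbf{F}_q[x]$ is a nontrivial $a$-self reciprocal monic polynomial with $g(\sqrt{a}) \neq 0$.
   Context: Let $q=p^e$ be an odd prime power and $\mathbf{F}_q$ the finite field with $q$ elements. For a nonzero $a\in\mathbf{F}_q$ and a monic polynomial $f(x)=\sum_{i=0}^n b_i x^i \in \mathbf{F}_q[x]$ of degree $n$ with $f(0)\neq 0$, the $a$-reciprocal of $f$ is $\hat{f}_a(x) := \frac{x^n}{f(0)} f\left(\frac{a}{x}\right) = \frac{1}{b_0}\sum_{i=0}^n b_i a^i x^{n-i}$. A monic polynomial $f(x)$ (with $f(0)\ne 0$) is $a$-self reciprocal if $\hat{f}_a(x)=f(x)$; comparing coefficients gives $b_0^2=a^n$. An $a$-self reciprocal monic polynomial of even degree $n=2m$ ($m\ge 0$) is called trivial if $b_0=-a^m$ and nontrivial if $b_0=a^m$. In particular the constant polynomial $1$ (degree $0$) counts as a nontrivial $a$-self reciprocal monic polynomial. -}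

module Defs where

open import Algebra.Apartness.Bundles using (HeytingField; HeytingCommutativeRing)
open import Algebra.Bundles using (CommutativeRing)
open import Algebra.Bundles.Raw using (RawRing)
import Algebra.Definitions.RawSemiring as RawSemiringDefinitions
open import Data.Fin.Base using (Fin; toℕ)
open import Data.List.Base using (List; []; _∷_; map)
open import Data.Nat.Base as ℕ using (ℕ; zero; suc; _∸_)
open import Data.Product.Base using (_×_; Σ-syntax; proj₁)
open import Function.Bundles using (Inverse)
open import Level using (Level; _⊔_)
open import Relation.Binary.Bundles using (Setoid)
import Relation.Binary.PropositionalEquality as ≡

HasCardinality : ∀ {c ℓ} → Setoid c ℓ → ℕ → Set (c ⊔ ℓ)
HasCardinality S q = Inverse S (≡.setoid (Fin q))

-- A polynomial is the list of its coefficients, constant term first.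
-- Trailing zeros are allowed, so equality is equality of all coefficients.
module Polynomials {c ℓ : Level} (R : RawRing c ℓ) where

  open RawRing R

  Poly : Set c
  Poly = List Carrier

  coeff : Poly → ℕ → Carrier
  coeff []      _       = 0#
  coeff (b ∷ f) zero    = b
  coeff (b ∷ f) (suc i) = coeff f i

  infix 4 _≈ᴾ_
  _≈ᴾ_ : Poly → Poly → Set ℓ
  f ≈ᴾ g = ∀ i → coeff f i ≈ coeff g i

  infixl 6 _+ᴾ_
  _+ᴾ_ : Poly → Poly → Poly
  []      +ᴾ g       = g
  (b ∷ f) +ᴾ []      = b ∷ f
  (b ∷ f) +ᴾ (d ∷ g) = (b + d) ∷ (f +ᴾ g)

  infixl 7 _*ᴾ_
  _*ᴾ_ : Poly → Poly → Poly
  []      *ᴾ g = []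
  (b ∷ f) *ᴾ g = map (b *_) g +ᴾ (0# ∷ f *ᴾ g)

  polyRawRing : RawRing c ℓ
  polyRawRing = record
    { Carrier = Poly
    ; _≈_     = _≈ᴾ_
    ; _+_     = _+ᴾ_
    ; _*_     = _*ᴾ_
    ; -_      = map (-_)
    ; 0#      = []
    ; 1#      = 1# ∷ []
    }

  open RawRing polyRawRing public
    using () renaming (-_ to -ᴾ_)
  open RawSemiringDefinitions (RawRing.rawSemiring polyRawRing) public
    using () renaming (_^_ to _^ᴾ_; _∤_ to _∤ᴾ_; sum to sumᴾ)

  infixl 6 _-ᴾ_
  _-ᴾ_ : Poly → Poly → Poly
  f -ᴾ g = f +ᴾ (-ᴾ g)

  C : Carrier → Poly
  C b = b ∷ []

  X : Poly
  X = 0# ∷ 1# ∷ []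

  eval : Poly → Carrier → Carrier
  eval []      x = 0#
  eval (b ∷ f) x = b + x * eval f x

  MonicOfDegree : ℕ → Poly → Set ℓ
  MonicOfDegree n f = coeff f n ≈ 1# × (∀ i → n ℕ.< i → coeff f i ≈ 0#)

-- In a Heyting field, "nonzero" is expressed by apartness from 0#, which is
-- equivalent to invertibility and, when the field is finite, to _≉ 0#.
module SelfReciprocal {c ℓ₁ ℓ₂ : Level} (F : HeytingField c ℓ₁ ℓ₂) where

  open HeytingField F
  private
    R : CommutativeRing c ℓ₁
    R = HeytingCommutativeRing.commutativeRing heytingCommutativeRing

  open Polynomials (CommutativeRing.rawRing R) public
  open RawSemiringDefinitions (RawRing.rawSemiring (CommutativeRing.rawRing R)) public
    using (_^_)

  -- The library's witness is an inverse of x - 0#, hence of x.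
  inverse : (x : Carrier) → x # 0# → Carrier
  inverse x x#0 = proj₁ (#⇒invertible x#0)

  -- b₀⁻¹ ∑ᵢ₌₀ⁿ bᵢ aⁱ xⁿ⁻ⁱ, where bᵢ = coeff f i and f has degree n
  reciprocal : (a : Carrier) (n : ℕ) (f : Poly) → coeff f 0 # 0# → Poly
  reciprocal a n f b₀#0 =
    C (inverse (coeff f 0) b₀#0) *ᴾ
    sumᴾ {suc n} (λ i → C (coeff f (toℕ i) * a ^ toℕ i) *ᴾ X ^ᴾ (n ∸ toℕ i))

  IsSelfReciprocal : (a : Carrier) (n : ℕ) → Poly → Set (ℓ₁ ⊔ ℓ₂)
  IsSelfReciprocal a n f =
    MonicOfDegree n f ×
    (Σ[ b₀#0 ∈ coeff f 0 # 0# ] reciprocal a n f b₀#0 ≈ᴾ f)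

  -- The degree is 2m.
  IsNontrivialSelfReciprocal : (a : Carrier) (m : ℕ) → Poly → Set (ℓ₁ ⊔ ℓ₂)
  IsNontrivialSelfReciprocal a m f =
    IsSelfReciprocal a (2 ℕ.* m) f × coeff f 0 ≈ a ^ m

{-# OPTIONS --safe #-}
module Submission where

open import Defs
open import Algebra.Apartness.Bundles using (HeytingField; HeytingCommutativeRing)
import Algebra.Apartness.Properties.HeytingCommutativeRing as HeytingProperties
open import Algebra.Bundles using (CommutativeRing)
import Algebra.Properties.CommutativeMonoid.Sum as Sum
import Algebra.Properties.CommutativeSemiring.Exp as Exp
import Algebra.Properties.Ring as RingProperties
import Algebra.Properties.Semiring.Sum as SemiringSum
import Algebra.Solver.Ring.NaturalCoefficients.Default as Solver
open import Data.Fin.Base as Fin using (Fin; toℕ; opposite)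
import Data.Fin.Permutation as Perm
import Data.Fin.Properties as Fin
open import Data.List.Base using ([]; _∷_; map)
open import Data.Nat.Base as ℕ using (ℕ; zero; suc; NonZero; z≤n; s≤s; _∸_) renaming (_^_ to _^ℕ_)
open import Data.Nat.Divisibility using (_∣_; _∤_; divides; ∣m∣n⇒∣m+n; ∣-refl)
open import Data.Nat.Primality using (Prime)
import Data.Nat.Properties as ℕ
open import Data.Product.Base using (_×_; _,_; proj₁; proj₂; ∃-syntax)
open import Data.Sum.Base using (_⊎_; inj₁; inj₂)
open import Function.Base using (_∘_)
open import Function.Bundles using (Inverse)
open import Function.Properties.Inverse using (Inverse⇒Injection)
open import Level using (_⊔_)
open import Relation.Binary.Definitions using (Decidable; tri<; tri≈; tri>)
import Relation.Binary.PropositionalEquality as ≡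
open ≡ using (_≡_; _≢_)
import Relation.Binary.Reasoning.Setoid as ≈-Reasoning
open import Relation.Nullary.Decidable using (yes; no; via-injection)
open import Relation.Nullary.Negation using (contradiction)

-- Let R_n f = xⁿ f(a/x) and s² = a. The operator R is multiplicative and
-- R₁(x - s) = -s (x - s), so if R_n f = c f and f = (x - s) h, then
-- R_{n-1} h = -(c/s) h. Evaluating R_n f = c f at s gives sⁿ f(s) = c f(s).
-- If f is nontrivial of degree 2m + 2 then c = s²ᵐ⁺², and a root at s leaves h of
-- degree 2m + 1 with factor -s²ᵐ⁺¹; hence 2 h(s) = 0, and h(s) = 0 in odd
-- characteristic. Dividing once more yields a polynomial of degree 2m with factor
-- s²ᵐ = aᵐ, so the factors x - s come off in pairs.

-- Parity of a finite set carrying a fixed-point-free involution.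

-- Every index is either an ascent `i < σ i` or a descent, never both. Reindexing the descents by
-- `σ` turns them into the ascents, so the set is counted as twice the number of ascents.
involution⇒2∣n : ∀ {n} (σ : Fin n → Fin n) → (∀ i → σ (σ i) ≡ i) → (∀ i → σ i ≢ i) → 2 ∣ n
involution⇒2∣n {n} σ involutive fixed-point-free = divides (sum below) (begin
  n                                     ≡⟨ sum-ones n ⟨
  sum {n} (λ _ → 1)                     ≡⟨ sum-cong-≗ (λ i → ascent+descent (fixed-point-free i ∘ ≡.sym)) ⟨
  sum (λ i → below i ℕ.+ χ (σ i) i)     ≡⟨ ∑-distrib-+ below (λ i → χ (σ i) i) ⟩
  sum below ℕ.+ sum (λ i → χ (σ i) i)
    ≡⟨ ≡.cong (sum below ℕ.+_) (sum-cong-≗ (λ i → ≡.cong (χ (σ i)) (involutive i))) ⟨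
  sum below ℕ.+ sum (below ∘ σ)
    ≡⟨ ≡.cong (sum below ℕ.+_) (sum-permute below (Perm.permutation σ σ involutive involutive)) ⟨
  sum below ℕ.+ sum below               ≡⟨ ≡.cong (sum below ℕ.+_) (ℕ.+-identityʳ _) ⟨
  2 ℕ.* sum below                       ≡⟨ ℕ.*-comm 2 (sum below) ⟩
  sum below ℕ.* 2                       ∎)
  where
  open Sum ℕ.+-0-commutativeMonoid
  open ≡.≡-Reasoning

  χ : ∀ {n} → Fin n → Fin n → ℕ
  χ i j with Fin.<-cmp i j
  ... | tri< _ _ _ = 1
  ... | tri≈ _ _ _ = 0
  ... | tri> _ _ _ = 0

  below : Fin n → ℕ
  below i = χ i (σ i)

  ascent+descent : ∀ {i j : Fin n} → i ≢ j → χ i j ℕ.+ χ j i ≡ 1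
  ascent+descent {i} {j} i≢j with Fin.<-cmp i j | Fin.<-cmp j i
  ... | tri< _ _ _   | tri> _ _ _   = ≡.refl
  ... | tri> _ _ _   | tri< _ _ _   = ≡.refl
  ... | tri< i<j _ _ | tri< j<i _ _ = contradiction j<i (Fin.<-asym i<j)
  ... | tri> _ _ j<i | tri> _ _ i<j = contradiction j<i (Fin.<-asym i<j)
  ... | tri≈ _ i≡j _ | _            = contradiction i≡j i≢j
  ... | tri< _ _ _   | tri≈ _ j≡i _ = contradiction (≡.sym j≡i) i≢j
  ... | tri> _ _ _   | tri≈ _ j≡i _ = contradiction (≡.sym j≡i) i≢j

  sum-ones : ∀ n → sum {n} (λ _ → 1) ≡ n
  sum-ones zero    = ≡.refl
  sum-ones (suc n) = ≡.cong suc (sum-ones n)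

-- Arithmetic of polynomials through their coefficients.

module PolynomialProperties {c ℓ} (R : CommutativeRing c ℓ) where

  open CommutativeRing R
  open Polynomials rawRing
  open SemiringSum semiring using (sum; *-distribˡ-sum; sum-cong-≋; sum-permute)
  open Exp commutativeSemiring using (_^_; ^-congˡ; ^-distrib-*; ^-homo-*)
  open Solver commutativeSemiring using (solve; _:+_; _:*_; _:=_)
  open ≈-Reasoning setoid

  coeff-+ᴾ : ∀ f g i → coeff (f +ᴾ g) i ≈ coeff f i + coeff g i
  coeff-+ᴾ []      g       i       = sym (+-identityˡ _)
  coeff-+ᴾ (b ∷ f) []      i       = sym (+-identityʳ _)
  coeff-+ᴾ (b ∷ f) (d ∷ g) zero    = refl
  coeff-+ᴾ (b ∷ f) (d ∷ g) (suc i) = coeff-+ᴾ f g i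

  coeff-scale : ∀ b f i → coeff (map (b *_) f) i ≈ b * coeff f i
  coeff-scale b []      i       = sym (zeroʳ b)
  coeff-scale b (d ∷ f) zero    = refl
  coeff-scale b (d ∷ f) (suc i) = coeff-scale b f i

  coeff-*ᴾ : ∀ b f g i →
             coeff ((b ∷ f) *ᴾ g) i ≈ b * coeff g i + coeff (0# ∷ f *ᴾ g) i
  coeff-*ᴾ b f g i =
    trans (coeff-+ᴾ (map (b *_) g) _ i) (+-congʳ (coeff-scale b g i))

  ∷-congˡ : ∀ {b f g} → f ≈ᴾ g → (b ∷ f) ≈ᴾ (b ∷ g)
  ∷-congˡ f≈g zero    = refl
  ∷-congˡ f≈g (suc i) = f≈g i

  *ᴾ-congˡ : ∀ f g h → g ≈ᴾ h → f *ᴾ g ≈ᴾ f *ᴾ h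
  *ᴾ-congˡ []      g h g≈h i = refl
  *ᴾ-congˡ (b ∷ f) g h g≈h i = begin
    coeff ((b ∷ f) *ᴾ g) i                ≈⟨ coeff-*ᴾ b f g i ⟩
    b * coeff g i + coeff (0# ∷ f *ᴾ g) i ≈⟨ +-cong (*-congˡ (g≈h i)) (∷-congˡ (*ᴾ-congˡ f g h g≈h) i) ⟩
    b * coeff h i + coeff (0# ∷ f *ᴾ h) i ≈⟨ coeff-*ᴾ b f h i ⟨
    coeff ((b ∷ f) *ᴾ h) i                ∎

  -- Prefixing `0#` is multiplication by x. This carries a coefficientwise induction hypothesis
  -- under that shift, where index 0 is a new case.
  coeff-shift-+ : ∀ {f g h} → (∀ i → coeff f i ≈ coeff g i + coeff h i) →
                  ∀ i → coeff (0# ∷ f) i ≈ coeff (0# ∷ g) i + coeff (0# ∷ h) i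
  coeff-shift-+ f≈g+h zero    = sym (+-identityˡ 0#)
  coeff-shift-+ f≈g+h (suc i) = f≈g+h i

  coeff-shift-scale : ∀ {b f g} → (∀ i → coeff f i ≈ b * coeff g i) →
                      ∀ i → coeff (0# ∷ f) i ≈ b * coeff (0# ∷ g) i
  coeff-shift-scale f≈bg zero    = sym (zeroʳ _)
  coeff-shift-scale f≈bg (suc i) = f≈bg i

  coeff-scale-*ᴾ : ∀ b f g i → coeff (map (b *_) f *ᴾ g) i ≈ b * coeff (f *ᴾ g) i
  coeff-scale-*ᴾ b []      g i = sym (zeroʳ b)
  coeff-scale-*ᴾ b (d ∷ f) g i = begin
    coeff (map (b *_) (d ∷ f) *ᴾ g) i
      ≈⟨ coeff-*ᴾ (b * d) (map (b *_) f) g i ⟩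
    b * d * coeff g i + coeff (0# ∷ map (b *_) f *ᴾ g) i
      ≈⟨ +-cong (*-assoc b d _) (coeff-shift-scale (coeff-scale-*ᴾ b f g) i) ⟩
    b * (d * coeff g i) + b * coeff (0# ∷ f *ᴾ g) i
      ≈⟨ distribˡ b _ _ ⟨
    b * (d * coeff g i + coeff (0# ∷ f *ᴾ g) i)
      ≈⟨ *-congˡ (coeff-*ᴾ d f g i) ⟨
    b * coeff ((d ∷ f) *ᴾ g) i ∎

  coeff-*ᴾ-distribʳ : ∀ h f g i →
                      coeff ((f +ᴾ g) *ᴾ h) i ≈ coeff (f *ᴾ h) i + coeff (g *ᴾ h) i
  coeff-*ᴾ-distribʳ h []      g       i = sym (+-identityˡ _)
  coeff-*ᴾ-distribʳ h (b ∷ f) []      i = sym (+-identityʳ _)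
  coeff-*ᴾ-distribʳ h (b ∷ f) (d ∷ g) i = begin
    coeff ((b + d ∷ f +ᴾ g) *ᴾ h) i
      ≈⟨ coeff-*ᴾ (b + d) (f +ᴾ g) h i ⟩
    (b + d) * coeff h i + coeff (0# ∷ (f +ᴾ g) *ᴾ h) i
      ≈⟨ +-congˡ (coeff-shift-+ (coeff-*ᴾ-distribʳ h f g) i) ⟩
    (b + d) * coeff h i + (coeff (0# ∷ f *ᴾ h) i + coeff (0# ∷ g *ᴾ h) i)
      ≈⟨ solve 5 (λ b d x y z → (b :+ d) :* x :+ (y :+ z) := (b :* x :+ y) :+ (d :* x :+ z))
           refl b d (coeff h i) (coeff (0# ∷ f *ᴾ h) i) (coeff (0# ∷ g *ᴾ h) i) ⟩
    (b * coeff h i + coeff (0# ∷ f *ᴾ h) i) + (d * coeff h i + coeff (0# ∷ g *ᴾ h) i)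
      ≈⟨ +-cong (coeff-*ᴾ b f h i) (coeff-*ᴾ d g h i) ⟨
    coeff ((b ∷ f) *ᴾ h) i + coeff ((d ∷ g) *ᴾ h) i ∎

  *ᴾ-assoc : ∀ f g h → (f *ᴾ g) *ᴾ h ≈ᴾ f *ᴾ (g *ᴾ h)
  *ᴾ-assoc []      g h i = refl
  *ᴾ-assoc (b ∷ f) g h i = begin
    coeff ((map (b *_) g +ᴾ (0# ∷ f *ᴾ g)) *ᴾ h) i
      ≈⟨ coeff-*ᴾ-distribʳ h (map (b *_) g) (0# ∷ f *ᴾ g) i ⟩
    coeff (map (b *_) g *ᴾ h) i + coeff ((0# ∷ f *ᴾ g) *ᴾ h) i
      ≈⟨ +-cong (coeff-scale-*ᴾ b g h i) (coeff-*ᴾ 0# (f *ᴾ g) h i) ⟩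
    b * coeff (g *ᴾ h) i + (0# * coeff h i + coeff (0# ∷ (f *ᴾ g) *ᴾ h) i)
      ≈⟨ +-congˡ (trans (+-congʳ (zeroˡ _)) (+-identityˡ _)) ⟩
    b * coeff (g *ᴾ h) i + coeff (0# ∷ (f *ᴾ g) *ᴾ h) i
      ≈⟨ +-congˡ (∷-congˡ (*ᴾ-assoc f g h) i) ⟩
    b * coeff (g *ᴾ h) i + coeff (0# ∷ f *ᴾ (g *ᴾ h)) i
      ≈⟨ coeff-*ᴾ b f (g *ᴾ h) i ⟨
    coeff ((b ∷ f) *ᴾ (g *ᴾ h)) i ∎

  coeff-C*ᴾ : ∀ b f i → coeff (C b *ᴾ f) i ≈ b * coeff f i
  coeff-C*ᴾ b f i = trans (coeff-*ᴾ b [] f i) (trans (+-congˡ (coeff-0∷[] i)) (+-identityʳ _))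
    where
    coeff-0∷[] : ∀ i → coeff (0# ∷ []) i ≈ 0#
    coeff-0∷[] zero    = refl
    coeff-0∷[] (suc i) = refl

  -- The list is x + b. This shape covers `X` itself and also `X -ᴾ C s`, which reduces to it with
  -- `0# + - s` for b.
  coeff-linear*ᴾ : ∀ b f i →
                   coeff ((b ∷ 1# ∷ []) *ᴾ f) i ≈ b * coeff f i + coeff (0# ∷ f) i
  coeff-linear*ᴾ b f i = trans (coeff-*ᴾ b (C 1#) f i) (+-congˡ (lemma i))
    where
    lemma : ∀ i → coeff (0# ∷ C 1# *ᴾ f) i ≈ coeff (0# ∷ f) i
    lemma zero    = refl
    lemma (suc i) = trans (coeff-C*ᴾ 1# f i) (*-identityˡ _)

  coeff-X*ᴾ : ∀ f i → coeff (X *ᴾ f) i ≈ coeff (0# ∷ f) i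
  coeff-X*ᴾ f i =
    trans (coeff-linear*ᴾ 0# f i) (trans (+-congʳ (zeroˡ _)) (+-identityˡ _))

  coeff-X^ᴾ-≡ : ∀ k → coeff (X ^ᴾ k) k ≈ 1#
  coeff-X^ᴾ-≡ zero    = refl
  coeff-X^ᴾ-≡ (suc k) = trans (coeff-X*ᴾ (X ^ᴾ k) (suc k)) (coeff-X^ᴾ-≡ k)

  coeff-X^ᴾ-≢ : ∀ k {j} → j ≢ k → coeff (X ^ᴾ k) j ≈ 0#
  coeff-X^ᴾ-≢ zero    {zero}  j≢k = contradiction ≡.refl j≢k
  coeff-X^ᴾ-≢ zero    {suc j} j≢k = refl
  coeff-X^ᴾ-≢ (suc k) {zero}  j≢k = coeff-X*ᴾ (X ^ᴾ k) 0
  coeff-X^ᴾ-≢ (suc k) {suc j} j≢k =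
    trans (coeff-X*ᴾ (X ^ᴾ k) (suc j)) (coeff-X^ᴾ-≢ k (j≢k ∘ ≡.cong suc))

  coeff-CX^ᴾ-≡ : ∀ b k → coeff (C b *ᴾ X ^ᴾ k) k ≈ b
  coeff-CX^ᴾ-≡ b k =
    trans (coeff-C*ᴾ b (X ^ᴾ k) k) (trans (*-congˡ (coeff-X^ᴾ-≡ k)) (*-identityʳ b))

  coeff-CX^ᴾ-≢ : ∀ b k {j} → j ≢ k → coeff (C b *ᴾ X ^ᴾ k) j ≈ 0#
  coeff-CX^ᴾ-≢ b k j≢k =
    trans (coeff-C*ᴾ b (X ^ᴾ k) _) (trans (*-congˡ (coeff-X^ᴾ-≢ k j≢k)) (zeroʳ b))

  -- Coefficients of a sum in descending powers.

  -- The sum inside `reciprocal`, with `u` left arbitrary: dropping the first summand then leaves a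
  -- sum of the same kind, for `u ∘ suc` and one degree lower.
  descending : (n : ℕ) → (ℕ → Carrier) → Poly
  descending n u = sumᴾ {suc n} (λ i → C (u (toℕ i)) *ᴾ X ^ᴾ (n ∸ toℕ i))

  coeff-descending-> : ∀ n u {j} → n ℕ.< j → coeff (descending n u) j ≈ 0#
  -- Only one summand reaches degree j. If i = 0 it is the first one, and the rest has too small a
  -- degree; otherwise the first one misses j and the induction continues in the rest.
  coeff-descending-≡ : ∀ n u {i j} → i ℕ.+ j ≡ n → coeff (descending n u) j ≈ u i

  coeff-descending-> zero u {j} n<j = begin
    coeff (C (u 0) *ᴾ X ^ᴾ 0 +ᴾ []) j ≈⟨ coeff-+ᴾ (C (u 0) *ᴾ X ^ᴾ 0) [] j ⟩
    coeff (C (u 0) *ᴾ X ^ᴾ 0) j + 0#  ≈⟨ +-identityʳ _ ⟩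
    coeff (C (u 0) *ᴾ X ^ᴾ 0) j       ≈⟨ coeff-CX^ᴾ-≢ (u 0) 0 (ℕ.>⇒≢ n<j) ⟩
    0#                                ∎
  coeff-descending-> (suc n) u {j} n<j = begin
    coeff (C (u 0) *ᴾ X ^ᴾ suc n +ᴾ descending n (u ∘ suc)) j
      ≈⟨ coeff-+ᴾ (C (u 0) *ᴾ X ^ᴾ suc n) _ j ⟩
    coeff (C (u 0) *ᴾ X ^ᴾ suc n) j + coeff (descending n (u ∘ suc)) j
      ≈⟨ +-cong (coeff-CX^ᴾ-≢ (u 0) (suc n) (ℕ.>⇒≢ n<j))
                (coeff-descending-> n (u ∘ suc) (ℕ.<-trans (ℕ.n<1+n n) n<j)) ⟩
    0# + 0# ≈⟨ +-identityˡ 0# ⟩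
    0#      ∎

  coeff-descending-≡ zero u {zero} ≡.refl = begin
    coeff (C (u 0) *ᴾ X ^ᴾ 0 +ᴾ []) 0 ≈⟨ coeff-+ᴾ (C (u 0) *ᴾ X ^ᴾ 0) [] 0 ⟩
    coeff (C (u 0) *ᴾ X ^ᴾ 0) 0 + 0#  ≈⟨ +-identityʳ _ ⟩
    coeff (C (u 0) *ᴾ X ^ᴾ 0) 0       ≈⟨ coeff-CX^ᴾ-≡ (u 0) 0 ⟩
    u 0                               ∎
  coeff-descending-≡ (suc n) u {zero} ≡.refl = begin
    coeff (C (u 0) *ᴾ X ^ᴾ suc n +ᴾ descending n (u ∘ suc)) (suc n)
      ≈⟨ coeff-+ᴾ (C (u 0) *ᴾ X ^ᴾ suc n) _ (suc n) ⟩
    coeff (C (u 0) *ᴾ X ^ᴾ suc n) (suc n) + coeff (descending n (u ∘ suc)) (suc n)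
      ≈⟨ +-cong (coeff-CX^ᴾ-≡ (u 0) (suc n)) (coeff-descending-> n (u ∘ suc) (ℕ.n<1+n n)) ⟩
    u 0 + 0# ≈⟨ +-identityʳ (u 0) ⟩
    u 0      ∎
  coeff-descending-≡ (suc n) u {suc i} {j} i+j≡n = begin
    coeff (C (u 0) *ᴾ X ^ᴾ suc n +ᴾ descending n (u ∘ suc)) j
      ≈⟨ coeff-+ᴾ (C (u 0) *ᴾ X ^ᴾ suc n) _ j ⟩
    coeff (C (u 0) *ᴾ X ^ᴾ suc n) j + coeff (descending n (u ∘ suc)) j
      ≈⟨ +-cong (coeff-CX^ᴾ-≢ (u 0) (suc n) (ℕ.<⇒≢ j<1+n))
                (coeff-descending-≡ n (u ∘ suc) (ℕ.suc-injective i+j≡n)) ⟩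
    0# + u (suc i) ≈⟨ +-identityˡ _ ⟩
    u (suc i)      ∎
    where
    j<1+n : j ℕ.< suc n
    j<1+n = s≤s (ℕ.m+n≤o⇒n≤o i (ℕ.≤-reflexive (ℕ.suc-injective i+j≡n)))

  -- Evaluation as a finite sum of powers.

  eval-zero : ∀ f x → (∀ i → coeff f i ≈ 0#) → eval f x ≈ 0#
  eval-zero []      x f≈0 = refl
  eval-zero (b ∷ f) x f≈0 = begin
    b + x * eval f x ≈⟨ +-cong (f≈0 0) (*-congˡ (eval-zero f x (f≈0 ∘ suc))) ⟩
    0# + x * 0#      ≈⟨ +-identityˡ _ ⟩
    x * 0#           ≈⟨ zeroʳ x ⟩
    0#               ∎

  -- Horner evaluation is recast over `Fin n` so that its terms can be permuted. Here n is a strict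
  -- bound on the degree, independent of the length of the list, which may end in zeros.
  eval≈sum : ∀ n f x → (∀ i → n ℕ.≤ i → coeff f i ≈ 0#) →
             eval f x ≈ sum {n} (λ i → coeff f (toℕ i) * x ^ toℕ i)
  eval≈sum zero    f       x vanishes = eval-zero f x (λ i → vanishes i z≤n)
  eval≈sum (suc n) []      x vanishes = begin
    0#                                 ≈⟨ zeroˡ _ ⟨
    0# * sum {suc n} (λ i → x ^ toℕ i) ≈⟨ *-distribˡ-sum {suc n} 0# (λ i → x ^ toℕ i) ⟩
    sum {suc n} (λ i → 0# * x ^ toℕ i) ∎
  eval≈sum (suc n) (b ∷ f) x vanishes = begin
    b + x * eval f x
      ≈⟨ +-cong (sym (*-identityʳ b))
           (*-congˡ (eval≈sum n f x (λ i n≤i → vanishes (suc i) (s≤s n≤i)))) ⟩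
    b * 1# + x * sum {n} (λ i → coeff f (toℕ i) * x ^ toℕ i)
      ≈⟨ +-congˡ (*-distribˡ-sum {n} x (λ i → coeff f (toℕ i) * x ^ toℕ i)) ⟩
    b * 1# + sum {n} (λ i → x * (coeff f (toℕ i) * x ^ toℕ i))
      ≈⟨ +-congˡ (sum-cong-≋ {n} (λ i →
           solve 3 (λ x y z → x :* (y :* z) := y :* (x :* z)) refl
             x (coeff f (toℕ i)) (x ^ toℕ i))) ⟩
    b * 1# + sum {n} (λ i → coeff f (toℕ i) * (x * x ^ toℕ i)) ∎

  -- Division by a linear factor.

  -- Synthetic division by X - s; the remainder is eval f s.
  quotient : Carrier → Poly → Poly
  quotient s []      = []
  quotient s (b ∷ f) = eval f s ∷ quotient s f

  -- With q the quotient, this is x q + f(s) = f + s q, the division identity without subtraction.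
  -- The list on the left consists of the Horner values of the successive tails of f.
  coeff-quotient : ∀ s f i → coeff (eval f s ∷ quotient s f) i ≈
                             coeff f i + s * coeff (quotient s f) i
  coeff-quotient s []      zero    = sym (trans (+-identityˡ _) (zeroʳ s))
  coeff-quotient s []      (suc i) = sym (trans (+-identityˡ _) (zeroʳ s))
  coeff-quotient s (b ∷ f) zero    = refl
  coeff-quotient s (b ∷ f) (suc i) = coeff-quotient s f i

  -- Coefficient i of the quotient is the Horner value of the tail of f starting at index i + 1.
  coeff-quotient-zero : ∀ s f i → (∀ j → i ℕ.< j → coeff f j ≈ 0#) →
                        coeff (quotient s f) i ≈ 0#
  coeff-quotient-zero s []      i       vanishes = refl
  coeff-quotient-zero s (b ∷ f) zero    vanishes =
    eval-zero f s (λ j → vanishes (suc j) (s≤s z≤n))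
  coeff-quotient-zero s (b ∷ f) (suc i) vanishes =
    coeff-quotient-zero s f i (λ j i<j → vanishes (suc j) (s≤s i<j))

  quotient-monic : ∀ s n {f} → MonicOfDegree (suc n) f → MonicOfDegree n (quotient s f)
  quotient-monic s n {f} (lead , vanishes) =
    (begin
      coeff (quotient s f) n                             ≈⟨ coeff-quotient s f (suc n) ⟩
      coeff f (suc n) + s * coeff (quotient s f) (suc n) ≈⟨ +-cong lead (*-congˡ (beyond (suc n) (ℕ.n<1+n n))) ⟩
      1# + s * 0#                                        ≈⟨ +-congˡ (zeroʳ s) ⟩
      1# + 0#                                            ≈⟨ +-identityʳ 1# ⟩
      1#                                                 ∎)
    , beyond
    where
    beyond : ∀ i → n ℕ.< i → coeff (quotient s f) i ≈ 0#
    beyond i n<i = coeff-quotient-zero s f i (λ j i<j → vanishes j (ℕ.≤-<-trans n<i i<j))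

  module _ {s f} (root : eval f s ≈ 0#) where

    -- At a root the remainder is zero, so the division identity becomes x q = f + s q.
    coeff-shift-quotient : ∀ i → coeff (0# ∷ quotient s f) i ≈
                                 coeff f i + s * coeff (quotient s f) i
    coeff-shift-quotient zero    = trans (sym root) (coeff-quotient s f 0)
    coeff-shift-quotient (suc i) = coeff-quotient s f (suc i)

    factor : f ≈ᴾ (X -ᴾ C s) *ᴾ quotient s f
    factor i = sym (begin
      coeff ((X -ᴾ C s) *ᴾ quotient s f) i
        ≈⟨ coeff-linear*ᴾ (0# + - s) (quotient s f) i ⟩
      (0# + - s) * q + coeff (0# ∷ quotient s f) i
        ≈⟨ +-cong (*-congʳ (+-identityˡ (- s))) (coeff-shift-quotient i) ⟩
      - s * q + (coeff f i + s * q)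
        ≈⟨ solve 4 (λ t s q b → t :* q :+ (b :+ s :* q) := b :+ (t :+ s) :* q)
             refl (- s) s q (coeff f i) ⟩
      coeff f i + (- s + s) * q
        ≈⟨ +-congˡ (trans (*-congʳ (-‿inverseˡ s)) (zeroˡ q)) ⟩
      coeff f i + 0#
        ≈⟨ +-identityʳ _ ⟩
      coeff f i ∎)
      where
      q : Carrier
      q = coeff (quotient s f) i

  -- Polynomials preserved up to a factor by x ↦ a/x.

  -- For deg f ≤ n: xⁿ f(a/x) = c f(x), compared coefficient by coefficient.
  Reversible : Carrier → ℕ → Carrier → Poly → Set ℓ
  Reversible a n c f = ∀ i {j} → i ℕ.+ j ≡ n → coeff f j * a ^ j ≈ c * coeff f i

  module _ {a s} (s*s≈a : s * s ≈ a) where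

    -- The point s is fixed by x ↦ a/x. To avoid dividing, the two sums are compared term by term,
    -- term n - i on the left against term i on the right.
    reversible-eval : ∀ n {c f} → (∀ i → n ℕ.< i → coeff f i ≈ 0#) →
                      Reversible a n c f → s ^ n * eval f s ≈ c * eval f s
    reversible-eval n {c} {f} vanishes rev = begin
      s ^ n * eval f s                    ≈⟨ *-congˡ (eval≈sum (suc n) f s vanishes) ⟩
      s ^ n * sum {suc n} term            ≈⟨ *-congˡ (sum-permute term Perm.reverse) ⟩
      s ^ n * sum {suc n} (term ∘ opposite) ≈⟨ *-distribˡ-sum {suc n} (s ^ n) (term ∘ opposite) ⟩
      sum {suc n} (λ i → s ^ n * term (opposite i)) ≈⟨ sum-cong-≋ {suc n} reflected ⟩
      sum {suc n} (λ i → c * term i)      ≈⟨ *-distribˡ-sum {suc n} c term ⟨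
      c * sum {suc n} term                ≈⟨ *-congˡ (eval≈sum (suc n) f s vanishes) ⟨
      c * eval f s                        ∎
      where
      term : Fin (suc n) → Carrier
      term i = coeff f (toℕ i) * s ^ toℕ i

      swap : ∀ i {j} → i ℕ.+ j ≡ n → s ^ n * (coeff f j * s ^ j) ≈ c * (coeff f i * s ^ i)
      swap i {j} ≡.refl = begin
        s ^ (i ℕ.+ j) * (coeff f j * s ^ j)   ≈⟨ *-congʳ (^-homo-* s i j) ⟩
        -- The second factor of s ^ j combines with the first into a ^ j, which is the form in which
        -- `rev` applies.
        s ^ i * s ^ j * (coeff f j * s ^ j)   ≈⟨ solve 3 (λ x y b → x :* y :* (b :* y) := x :* (b :* (y :* y)))
                                                   refl (s ^ i) (s ^ j) (coeff f j) ⟩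
        s ^ i * (coeff f j * (s ^ j * s ^ j)) ≈⟨ *-congˡ (*-congˡ (^-distrib-* s s j)) ⟨
        s ^ i * (coeff f j * (s * s) ^ j)     ≈⟨ *-congˡ (*-congˡ (^-congˡ j s*s≈a)) ⟩
        s ^ i * (coeff f j * a ^ j)           ≈⟨ *-congˡ (rev i ≡.refl) ⟩
        s ^ i * (c * coeff f i)               ≈⟨ solve 3 (λ x c b → x :* (c :* b) := c :* (b :* x))
                                                   refl (s ^ i) c (coeff f i) ⟩
        c * (coeff f i * s ^ i)               ∎

      reflected : ∀ i → s ^ n * term (opposite i) ≈ c * term i
      reflected i = swap (toℕ i)
        (≡.trans (≡.cong (toℕ i ℕ.+_) (Fin.opposite-prop i)) (ℕ.m+[n∸m]≡n (Fin.toℕ≤pred[n] i)))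

    -- If f = (X - s) q then xⁿ⁺¹ f(a/x) = -s (x - s) xⁿ q(a/x), so the factor
    -- changes from c to c′ with c = -s c′.
    reversible-quotient : (∀ {x y} → a * x ≈ a * y → x ≈ y) →
      ∀ n {c c′ f} → c + s * c′ ≈ 0# → eval f s ≈ 0# →
      (∀ i → suc n ℕ.< i → coeff f i ≈ 0#) →
      Reversible a (suc n) c f → Reversible a n c′ (quotient s f)
    reversible-quotient a-cancel n {c} {c′} {f} c+sc′≈0 root vanishes rev i i+j≡n =
      shifted (suc i) (≡.cong suc i+j≡n)
      where
      q : Poly
      q = quotient s f

      -- Reading the right side off x q instead of q adds the case i = 0, where both sides vanish.
      -- It starts an induction that raises i and lowers j with their sum fixed.
      shifted : ∀ i {j} → i ℕ.+ j ≡ suc n → coeff q j * a ^ j ≈ c′ * coeff (0# ∷ q) i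
      shifted zero ≡.refl = begin
        coeff q (suc n) * a ^ suc n ≈⟨ *-congʳ (coeff-quotient-zero s f (suc n) vanishes) ⟩
        0# * a ^ suc n              ≈⟨ zeroˡ _ ⟩
        0#                          ≈⟨ zeroʳ c′ ⟨
        c′ * 0#                     ∎
      -- The extra factor a raises a ^ j to a ^ (j + 1), so that both `rev` and the induction
      -- hypothesis apply at index j + 1.
      shifted (suc i) {j} i+j≡n = a-cancel (begin
        a * (coeff q j * a ^ j)
          ≈⟨ solve 3 (λ x y z → x :* (y :* z) := y :* (x :* z)) refl a (coeff q j) (a ^ j) ⟩
        coeff q j * a ^ suc j
          ≈⟨ *-congʳ (coeff-shift-quotient {f = f} root (suc j)) ⟩
        (coeff f (suc j) + s * coeff q (suc j)) * a ^ suc j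
          ≈⟨ solve 4 (λ x s y z → (x :+ s :* y) :* z := x :* z :+ s :* (y :* z)) refl
               (coeff f (suc j)) s (coeff q (suc j)) (a ^ suc j) ⟩
        coeff f (suc j) * a ^ suc j + s * (coeff q (suc j) * a ^ suc j)
          ≈⟨ +-cong (rev i i+1+j≡n) (*-congˡ (shifted i i+1+j≡n)) ⟩
        c * coeff f i + s * (c′ * coeff (0# ∷ q) i)
          ≈⟨ +-congˡ (*-congˡ (*-congˡ (coeff-shift-quotient {f = f} root i))) ⟩
        c * coeff f i + s * (c′ * (coeff f i + s * coeff q i))
          -- Grouping isolates c + s c′, which is zero by hypothesis, and leaves s * s = a as the
          -- factor to cancel.
          ≈⟨ solve 5 (λ c s c′ x y → c :* x :+ s :* (c′ :* (x :+ s :* y)) :=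
                                     (c :+ s :* c′) :* x :+ s :* s :* (c′ :* y))
               refl c s c′ (coeff f i) (coeff q i) ⟩
        (c + s * c′) * coeff f i + s * s * (c′ * coeff q i)
          ≈⟨ +-cong (trans (*-congʳ c+sc′≈0) (zeroˡ _)) (*-congʳ s*s≈a) ⟩
        0# + a * (c′ * coeff q i)
          ≈⟨ +-identityˡ _ ⟩
        a * (c′ * coeff q i) ∎)
        where
        i+1+j≡n : i ℕ.+ suc j ≡ suc n
        i+1+j≡n = ≡.trans (ℕ.+-suc i j) i+j≡n

-- Inverses and cancellation in a Heyting field.

module _ {c ℓ₁ ℓ₂} (F : HeytingField c ℓ₁ ℓ₂) where

  open HeytingField F
  open SelfReciprocal F
  open HeytingProperties heytingCommutativeRing using (x-0≈x; 1#0; x#0y#0→xy#0; #-congʳ; invertibleˡ⇒#)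

  private
    R : CommutativeRing c ℓ₁
    R = HeytingCommutativeRing.commutativeRing heytingCommutativeRing

  open CommutativeRing R using (commutativeSemiring; ring)
  open PolynomialProperties R
  open Exp commutativeSemiring using (^-congˡ; ^-assocʳ)
  open RingProperties ring using (-‿distribʳ-*; +-identityʳ-unique)
  open Solver commutativeSemiring using (solve; _:+_; _:*_; _:=_; con)
  open ≈-Reasoning setoid

  inverse*x≈1 : ∀ {x} (x#0 : x # 0#) → inverse x x#0 * x ≈ 1#
  inverse*x≈1 {x} x#0 =
    trans (*-congˡ (sym (x-0≈x x))) (proj₁ (proj₂ (#⇒invertible x#0)))

  inverse*[x*y]≈y : ∀ {x} (x#0 : x # 0#) y → inverse x x#0 * (x * y) ≈ y
  inverse*[x*y]≈y {x} x#0 y = begin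
    inverse x x#0 * (x * y) ≈⟨ *-assoc _ x y ⟨
    inverse x x#0 * x * y   ≈⟨ *-congʳ (inverse*x≈1 x#0) ⟩
    1# * y                  ≈⟨ *-identityˡ y ⟩
    y                       ∎

  *-cancelˡ : ∀ {x y z} → x # 0# → x * y ≈ x * z → y ≈ z
  *-cancelˡ {x} {y} {z} x#0 xy≈xz = begin
    y                       ≈⟨ inverse*[x*y]≈y x#0 y ⟨
    inverse x x#0 * (x * y) ≈⟨ *-congˡ xy≈xz ⟩
    inverse x x#0 * (x * z) ≈⟨ inverse*[x*y]≈y x#0 z ⟩
    z                       ∎

  leftInverse⇒#0 : ∀ {x y} → y * x ≈ 1# → x # 0#
  leftInverse⇒#0 {x} {y} yx≈1 = invertibleˡ⇒# (y , trans (*-congˡ (x-0≈x x)) yx≈1)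

  ^#0 : ∀ {x} n → x # 0# → x ^ n # 0#
  ^#0 zero    x#0 = 1#0
  ^#0 (suc n) x#0 = x#0y#0→xy#0 x#0 (^#0 n x#0)

  -- Consequences of finiteness and odd order.

  module _ {q} (card : HasCardinality setoid q) where

    open Inverse card using (to; from; to-cong; from-cong; strictlyInverseˡ; strictlyInverseʳ)

    _≟_ : Decidable _≈_
    _≟_ = via-injection (Inverse⇒Injection card) Fin._≟_

    -- Invertibility can be decided by searching through the finite field.
    ≈0⊎#0 : ∀ x → x ≈ 0# ⊎ x # 0#
    ≈0⊎#0 x with Fin.any? (λ i → (from i * x) ≟ 1#)
    ... | yes (i , yx≈1) = inj₂ (leftInverse⇒#0 yx≈1)
    -- By tightness it suffices to refute apartness: an x apart from zero has an inverse, and its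
    -- index would have ended the search successfully.
    ... | no  noInverse  = inj₁ (proj₁ (tight x 0#) (λ x#0 → noInverse
      (to (inverse x x#0) ,
       trans (*-congʳ (strictlyInverseʳ (inverse x x#0))) (inverse*x≈1 x#0))))

    -- In characteristic 2, x ↦ x + 1 is a fixed-point-free involution.
    odd⇒2#0 : 2 ∤ q → 1# + 1# # 0#
    odd⇒2#0 2∤q with ≈0⊎#0 (1# + 1#)
    ... | inj₂ 2#0 = 2#0
    ... | inj₁ 2≈0 = contradiction (involution⇒2∣n σ involutive fixed-point-free) 2∤q
      where
      σ : Fin q → Fin q
      σ i = to (from i + 1#)

      involutive : ∀ i → σ (σ i) ≡ i
      involutive i = ≡.trans (to-cong (begin
        from (to (from i + 1#)) + 1# ≈⟨ +-congʳ (strictlyInverseʳ _) ⟩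
        from i + 1# + 1#             ≈⟨ +-assoc _ _ _ ⟩
        from i + (1# + 1#)           ≈⟨ +-congˡ 2≈0 ⟩
        from i + 0#                  ≈⟨ +-identityʳ _ ⟩
        from i                       ∎)) (strictlyInverseˡ i)

      fixed-point-free : ∀ i → σ i ≢ i
      fixed-point-free i σi≡i = proj₂ (tight 1# 0#) (+-identityʳ-unique (from i) 1# (begin
        from i + 1#             ≈⟨ strictlyInverseʳ _ ⟨
        from (to (from i + 1#)) ≈⟨ from-cong σi≡i ⟩
        from i                  ∎)) 1#0

  -- Self reciprocity as a reversal relation.

  module _ {a : Carrier} {n : ℕ} {f : Poly} (b₀#0 : coeff f 0 # 0#) where

    -- Multiplying through by the constant term removes its inverse from the formula.
    coeff-reciprocal : ∀ i {j} → i ℕ.+ j ≡ n →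
                       coeff f 0 * coeff (reciprocal a n f b₀#0) j ≈ coeff f i * a ^ i
    coeff-reciprocal i {j} i+j≡n = begin
      coeff f 0 * coeff (reciprocal a n f b₀#0) j
        ≈⟨ *-congˡ (coeff-C*ᴾ b₀⁻¹ (descending n u) j) ⟩
      coeff f 0 * (b₀⁻¹ * coeff (descending n u) j)
        ≈⟨ solve 3 (λ x y z → x :* (y :* z) := y :* (x :* z)) refl (coeff f 0) b₀⁻¹ _ ⟩
      b₀⁻¹ * (coeff f 0 * coeff (descending n u) j)
        ≈⟨ inverse*[x*y]≈y b₀#0 _ ⟩
      coeff (descending n u) j
        ≈⟨ coeff-descending-≡ n u i+j≡n ⟩
      coeff f i * a ^ i ∎
      where
      b₀⁻¹ : Carrier
      b₀⁻¹ = inverse (coeff f 0) b₀#0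

      u : ℕ → Carrier
      u i = coeff f i * a ^ i

    coeff-reciprocal-> : ∀ {j} → n ℕ.< j → coeff (reciprocal a n f b₀#0) j ≈ 0#
    coeff-reciprocal-> {j} n<j = begin
      coeff (reciprocal a n f b₀#0) j              ≈⟨ coeff-C*ᴾ b₀⁻¹ (descending n u) j ⟩
      b₀⁻¹ * coeff (descending n u) j              ≈⟨ *-congˡ (coeff-descending-> n u n<j) ⟩
      b₀⁻¹ * 0#                                    ≈⟨ zeroʳ _ ⟩
      0#                                           ∎
      where
      b₀⁻¹ : Carrier
      b₀⁻¹ = inverse (coeff f 0) b₀#0

      u : ℕ → Carrier
      u i = coeff f i * a ^ i

  -- Once the denominator is cleared, the reversal factor is the constant term, and nontriviality
  -- says that this is a ^ m.
  nontrivial⇒reversible : ∀ {a m f} → IsNontrivialSelfReciprocal a m f →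
                          Reversible a (2 ℕ.* m) (a ^ m) f
  nontrivial⇒reversible {a} {m} {f} ((_ , b₀#0 , recip≈f) , b₀≈aᵐ) i {j} i+j≡n = begin
    coeff f j * a ^ j
      ≈⟨ coeff-reciprocal {n = 2 ℕ.* m} {f} b₀#0 j (≡.trans (ℕ.+-comm j i) i+j≡n) ⟨
    coeff f 0 * coeff (reciprocal a (2 ℕ.* m) f b₀#0) i
      ≈⟨ *-cong b₀≈aᵐ (recip≈f i) ⟩
    a ^ m * coeff f i ∎

  -- The constant term is recovered from the relation: at i = n and j = 0 it equals a ^ m times the
  -- leading coefficient 1. This gives nontriviality, and with a apart from zero also the
  -- invertibility of the constant term.
  reversible⇒nontrivial : ∀ {a m f} → a # 0# → MonicOfDegree (2 ℕ.* m) f →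
                          Reversible a (2 ℕ.* m) (a ^ m) f → IsNontrivialSelfReciprocal a m f
  reversible⇒nontrivial {a} {m} {f} a#0 monic@(lead , vanishes) rev =
    (monic , b₀#0 , recip≈f) , b₀≈aᵐ
    where
    n : ℕ
    n = 2 ℕ.* m

    b₀≈aᵐ : coeff f 0 ≈ a ^ m
    b₀≈aᵐ = begin
      coeff f 0         ≈⟨ *-identityʳ _ ⟨
      coeff f 0 * 1#    ≈⟨ rev n (ℕ.+-identityʳ n) ⟩
      a ^ m * coeff f n ≈⟨ *-congˡ lead ⟩
      a ^ m * 1#        ≈⟨ *-identityʳ _ ⟩
      a ^ m             ∎

    b₀#0 : coeff f 0 # 0#
    b₀#0 = #-congʳ (sym b₀≈aᵐ) (^#0 m a#0)

    recip≈f : reciprocal a n f b₀#0 ≈ᴾ f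
    recip≈f i with i ℕ.≤? n
    -- Polynomial equality ranges over all indices; beyond the degree both sides are zero.
    ... | no  i≰n = trans (coeff-reciprocal-> {n = n} {f} b₀#0 (ℕ.≰⇒> i≰n))
                          (sym (vanishes i (ℕ.≰⇒> i≰n)))
    ... | yes i≤n = *-cancelˡ b₀#0 (begin
      coeff f 0 * coeff (reciprocal a n f b₀#0) i
        ≈⟨ coeff-reciprocal {n = n} {f} b₀#0 (n ∸ i) (ℕ.m∸n+n≡m i≤n) ⟩
      coeff f (n ∸ i) * a ^ (n ∸ i)
        ≈⟨ rev i (ℕ.m+[n∸m]≡n i≤n) ⟩
      a ^ m * coeff f i
        ≈⟨ *-congʳ b₀≈aᵐ ⟨
      coeff f 0 * coeff f i ∎)

  -- Removing the root in pairs.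

  module _ (≈0⊎#0 : ∀ x → x ≈ 0# ⊎ x # 0#) (2#0 : 1# + 1# # 0#)
           {a s} (a#0 : a # 0#) (s*s≈a : s * s ≈ a) where

    private
      L : Poly
      L = X -ᴾ C s

    -- The cofactor is described by `Reversible`, the form in which the recursion produces it; it is
    -- translated back to self reciprocity only at the end.
    Factorisation : Poly → Set (c ⊔ ℓ₁ ⊔ ℓ₂)
    Factorisation f = ∃[ k ] ∃[ g ] ∃[ m ]
      (2 ∣ k × f ≈ᴾ L ^ᴾ k *ᴾ g ×
       (MonicOfDegree (2 ℕ.* m) g × Reversible a (2 ℕ.* m) (a ^ m) g) ×
       eval g s # 0#)

    s#0 : s # 0#
    s#0 = leftInverse⇒#0 (trans (*-assoc _ s s) (trans (*-congˡ s*s≈a) (inverse*x≈1 a#0)))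

    s^2m≈a^m : ∀ m → s ^ (2 ℕ.* m) ≈ a ^ m
    s^2m≈a^m m = begin
      s ^ (2 ℕ.* m)  ≈⟨ ^-assocʳ s 2 m ⟨
      (s ^ 2) ^ m    ≈⟨ ^-congˡ m (trans (*-congˡ (*-identityʳ s)) s*s≈a) ⟩
      a ^ m          ∎

    odd-reversible-root : ∀ m {h} → MonicOfDegree (suc (2 ℕ.* m)) h →
      Reversible a (suc (2 ℕ.* m)) (- (s * a ^ m)) h → eval h s ≈ 0#
    odd-reversible-root m {h} (_ , vanishes) rev =
      -- The cancelled factor is 2 s a ^ m. Since s ^ (2m + 1) = s a ^ m is the negative of the
      -- reversal factor, evaluation at s makes twice the value vanish.
      *-cancelˡ (x#0y#0→xy#0 2#0 (x#0y#0→xy#0 s#0 (^#0 m a#0))) (begin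
        (1# + 1#) * y * eval h s
          ≈⟨ solve 2 (λ y e → (con 1 :+ con 1) :* y :* e := y :* e :+ y :* e) refl y (eval h s) ⟩
        y * eval h s + y * eval h s
          ≈⟨ +-congʳ (*-congʳ (*-congˡ (s^2m≈a^m m))) ⟨
        s ^ suc (2 ℕ.* m) * eval h s + y * eval h s
          ≈⟨ +-congʳ (reversible-eval s*s≈a (suc (2 ℕ.* m)) {f = h} vanishes rev) ⟩
        - y * eval h s + y * eval h s
          ≈⟨ distribʳ _ _ _ ⟨
        (- y + y) * eval h s
          ≈⟨ trans (*-congʳ (-‿inverseˡ y)) (zeroˡ _) ⟩
        0#
          ≈⟨ zeroʳ _ ⟨
        (1# + 1#) * y * 0# ∎)
      where
      y : Carrier
      y = s * a ^ m

    -- Recursion on half the degree: stop when s is not a root, otherwise divide by x - s twice.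
    reversible-factorisation : ∀ m f → MonicOfDegree (2 ℕ.* m) f →
      Reversible a (2 ℕ.* m) (a ^ m) f →
      Factorisation f
    reversible-factorisation m f monic rev with ≈0⊎#0 (eval f s)
    ... | inj₂ f[s]#0 = 0 , f , m , divides 0 ≡.refl , f≈1*f , (monic , rev) , f[s]#0
      where
      f≈1*f : f ≈ᴾ (1# ∷ []) *ᴾ f
      f≈1*f i = sym (trans (coeff-C*ᴾ 1# f i) (*-identityˡ _))
    -- In degree 0 the monic polynomial is 1, so it has no root.
    reversible-factorisation zero f (lead , vanishes) rev | inj₁ f[s]≈0 =
      contradiction 1#0 (proj₂ (tight 1# 0#) (begin
        1#                   ≈⟨ lead ⟨
        coeff f 0            ≈⟨ solve 1 (λ b → b := b :* con 1 :+ con 0) refl (coeff f 0) ⟩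
        coeff f 0 * 1# + 0#  ≈⟨ eval≈sum 1 f s vanishes ⟨
        eval f s             ≈⟨ f[s]≈0 ⟩
        0#                   ∎))
    reversible-factorisation (suc m) f monic rev | inj₁ f[s]≈0
      -- Exposes the degree as 2 + 2m, one successor for each division.
      rewrite ℕ.*-suc 2 m
      = extend (reversible-factorisation m f₂ f₂-monic f₂-rev)
      where
      f₁ f₂ : Poly
      f₁ = quotient s f
      f₂ = quotient s f₁

      f₁-monic : MonicOfDegree (suc (2 ℕ.* m)) f₁
      f₁-monic = quotient-monic s _ {f} monic

      f₁-rev : Reversible a (suc (2 ℕ.* m)) (- (s * a ^ m)) f₁
      -- The factor passes from a ^ (m + 1) to - s a ^ m, because s * s = a.
      f₁-rev = reversible-quotient s*s≈a (*-cancelˡ a#0) _ {f = f} (begin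
        a * a ^ m + s * - (s * a ^ m)   ≈⟨ +-congˡ (-‿distribʳ-* s _) ⟨
        a * a ^ m + - (s * (s * a ^ m)) ≈⟨ +-congˡ (-‿cong (trans (sym (*-assoc s s _)) (*-congʳ s*s≈a))) ⟩
        a * a ^ m + - (a * a ^ m)       ≈⟨ -‿inverseʳ _ ⟩
        0#                              ∎) f[s]≈0 (proj₂ monic) rev

      f₁[s]≈0 : eval f₁ s ≈ 0#
      f₁[s]≈0 = odd-reversible-root m {f₁} f₁-monic f₁-rev

      f₂-monic : MonicOfDegree (2 ℕ.* m) f₂
      f₂-monic = quotient-monic s _ {f₁} f₁-monic

      f₂-rev : Reversible a (2 ℕ.* m) (a ^ m) f₂
      -- The second division undoes the sign: - s a ^ m passes to a ^ m, the nontrivial factor for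
      -- degree 2m.
      f₂-rev = reversible-quotient s*s≈a (*-cancelˡ a#0) _ {f = f₁} (-‿inverseˡ _)
        f₁[s]≈0 (proj₂ f₁-monic) f₁-rev

      extend : Factorisation f₂ → Factorisation f
      extend (k , g , m′ , 2∣k , f₂≈ , g-rev , g[s]#0) =
        suc (suc k) , g , m′ , ∣m∣n⇒∣m+n ∣-refl 2∣k , f≈ , g-rev , g[s]#0
        where
        f≈ : f ≈ᴾ L ^ᴾ suc (suc k) *ᴾ g
        f≈ i = begin
          coeff f i
            ≈⟨ factor {f = f} f[s]≈0 i ⟩
          coeff (L *ᴾ f₁) i
            ≈⟨ *ᴾ-congˡ L f₁ (L *ᴾ f₂) (factor {f = f₁} f₁[s]≈0) i ⟩
          coeff (L *ᴾ (L *ᴾ f₂)) i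
            ≈⟨ *ᴾ-congˡ L (L *ᴾ f₂) (L *ᴾ (L ^ᴾ k *ᴾ g)) (*ᴾ-congˡ L f₂ (L ^ᴾ k *ᴾ g) f₂≈) i ⟩
          coeff (L *ᴾ (L *ᴾ (L ^ᴾ k *ᴾ g))) i
            ≈⟨ *ᴾ-congˡ L (L ^ᴾ suc k *ᴾ g) (L *ᴾ (L ^ᴾ k *ᴾ g)) (*ᴾ-assoc L (L ^ᴾ k) g) i ⟨
          coeff (L *ᴾ (L ^ᴾ suc k *ᴾ g)) i
            ≈⟨ *ᴾ-assoc L (L ^ᴾ suc k) g i ⟨
          coeff (L ^ᴾ suc (suc k) *ᴾ g) i ∎

theorem4 : ∀ {c ℓ₁ ℓ₂} (F : HeytingField c ℓ₁ ℓ₂) →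
    let open HeytingField F
        open SelfReciprocal F
    in
    (p e : ℕ) → Prime p → NonZero e → 2 ∤ p ^ℕ e → HasCardinality setoid (p ^ℕ e) →
    (a √a : Carrier) → a # 0# → √a * √a ≈ a →
    (m : ℕ) (f : Poly) → IsNontrivialSelfReciprocal a m f →
    (X ^ᴾ 2 -ᴾ C a) ∤ᴾ f → eval f √a ≈ 0# →
    ∃[ k ] ∃[ g ] ∃[ m′ ]
      (2 ∣ k ×
       f ≈ᴾ (X -ᴾ C √a) ^ᴾ k *ᴾ g ×
       IsNontrivialSelfReciprocal a m′ g ×
       eval g √a # 0#)
theorem4 F p e _ _ 2∤q card a √a a#0 √a*√a≈a m f f-nontrivial _ _
  with k , g , m′ , 2∣k , f≈ , (g-monic , g-rev) , g[√a]#0 ←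
         reversible-factorisation F (≈0⊎#0 F card) (odd⇒2#0 F card 2∤q) a#0 √a*√a≈a
           m f (proj₁ (proj₁ f-nontrivial)) (nontrivial⇒reversible F {m = m} {f} f-nontrivial)
  = k , g , m′ , 2∣k , f≈ , reversible⇒nontrivial F {m = m′} {g} a#0 g-monic g-rev , g[√a]#0
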